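{- Let $w$ be a recurrent aperiodic infinite binary word over the alphabet $\{0,1\}$. Then the following are equivalent: (1) $w$ is Sturmian. (2) For all factors $v,v'$ of $w$ of equal length, if $v<_{\mathrm{lex}}v'$ then $|v|_1\le |v'|_1$. (3) For any pair $v,v'$ of lexicographically consecutive factors of $w$ of the same length, $v$ and $v'$ differ in at most two positions.
   Context: The alphabet is ordered by $0<1$. A factor of $w$ is a finite word occurring as a block of consecutive letters of $w$; $\mathrm{Fact}(w)$ is the set of factors. $|v|_1$ is the number of occurrences of the letter $1$ in $v$. For finite words, $v<_{\mathrm{lex}}v'$ means $|v|=|v'|$ and there are a word $\lambda$ and letters $a<b$ such that $\lambda a$ is a prefix of $v$ and $\lambda b$ is a prefix of $v'$. Two factors $v,v'$ of $w$ are lexicographically consecutive (written $v'=\mathrm{succ}_w(v)$) if $v<_{\mathrm{lex}}v'$ and there is no $f\in\mathrm{Fact}(w)$ with $v<_{\mathrm{lex}}f<_{\mathrm{lex}}v'$. An infinite word is recurrent if each of its factors occurs infinitely often in it. It is aperiodic if it is not ultimately periodic, i.e. it has no tail of the form $v^\omega=vvv\cdots$ with $v$ a nonempty finite word. An infinite word $w$ is Sturmian if for every $n\ge 0$ it has exactly $n+1$ distinct factors of length $n$ (equivalently, $w$ is a binary aperiodic word such that for any two factors $u,u'$ of equal length and each letter $x$, the numbers of occurrences of $x$ in $u$ and in $u'$ differ by at most $1$). -}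

module Defs where

open import Data.Fin.Base using (Fin; _<_)
open import Data.Fin.Patterns using (1F)
open import Data.Fin.Properties using (_≟_)
open import Data.List.Base using (List; []; _∷_; _∷ʳ_; length; filter; zip; lookup; applyUpTo)
open import Data.List.Membership.Propositional using (_∈_)
open import Data.List.Relation.Binary.Prefix.Heterogeneous using (Prefix)
open import Data.List.Relation.Unary.Unique.Propositional using (Unique)
open import Data.Nat.Base using (ℕ; suc; _+_; _≤_; _≥_)
open import Data.Nat.DivMod using (_mod_)
open import Data.Product.Base using (_×_; _,_; ∃-syntax)
open import Function.Bundles using (_⇔_)
open import Relation.Binary.PropositionalEquality.Core using (_≡_)
open import Relation.Nullary.Decidable using (¬?)
open import Relation.Nullary.Negation.Core using (¬_)

Letter : Set
Letter = Fin 2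

FiniteWord : Set
FiniteWord = List Letter

InfiniteWord : Set
InfiniteWord = ℕ → Letter

block : InfiniteWord → ℕ → ℕ → FiniteWord
block w i n = applyUpTo (λ j → w (i + j)) n

OccursAt : InfiniteWord → FiniteWord → ℕ → Set
OccursAt w v i = block w i (length v) ≡ v

Fact : InfiniteWord → FiniteWord → Set
Fact w v = ∃[ i ] OccursAt w v i

∣_∣₁ : FiniteWord → ℕ
∣ v ∣₁ = length (filter (_≟ 1F) v)

infix 4 _<lex_

_<lex_ : FiniteWord → FiniteWord → Set
v <lex v′ =
  length v ≡ length v′ ×
  (∃[ l ] ∃[ a ] ∃[ b ] a < b × Prefix _≡_ (l ∷ʳ a) v × Prefix _≡_ (l ∷ʳ b) v′)

Consecutive : InfiniteWord → FiniteWord → FiniteWord → Set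
Consecutive w v v′ =
  Fact w v × Fact w v′ × v <lex v′ ×
  ¬ (∃[ f ] Fact w f × v <lex f × f <lex v′)

-- Number of positions at which two words differ.  `zip` truncates to the
-- shorter word, so this is meaningful only for words of equal length.
differences : FiniteWord → FiniteWord → ℕ
differences v v′ = length (filter (λ (a , b) → ¬? (a ≟ b)) (zip v v′))

Recurrent : InfiniteWord → Set
Recurrent w = ∀ v → Fact w v → ∀ N → ∃[ i ] i ≥ N × OccursAt w v i

-- The periodic word vvv⋯ with v = a ∷ u, so that v is nonempty.
_∷_^ω : Letter → FiniteWord → InfiniteWord
(a ∷ u ^ω) i = lookup (a ∷ u) (i mod suc (length u))

UltimatelyPeriodic : InfiniteWord → Set
UltimatelyPeriodic w = ∃[ k ] ∃[ a ] ∃[ u ] ∀ i → w (k + i) ≡ (a ∷ u ^ω) i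

Aperiodic : InfiniteWord → Set
Aperiodic w = ¬ UltimatelyPeriodic w

-- For every n, the factors of length n are listed without repetition by a list
-- of length n + 1.
Sturmian : InfiniteWord → Set
Sturmian w = ∀ n → ∃[ vs ]
  length vs ≡ suc n × Unique vs × (∀ v → v ∈ vs ⇔ (Fact w v × length v ≡ n))

LexMonotoneWeight : InfiniteWord → Set
LexMonotoneWeight w = ∀ v v′ → Fact w v → Fact w v′ → length v ≡ length v′ →
  v <lex v′ → ∣ v ∣₁ ≤ ∣ v′ ∣₁

ConsecutiveDifferAtMostTwo : InfiniteWord → Set
ConsecutiveDifferAtMostTwo w = ∀ v v′ → length v ≡ length v′ →
  Consecutive w v v′ → differences v v′ ≤ 2

{-# OPTIONS --safe #-}
module Submission where

-- A bad pair is a pair of factors xux, yuy with x ≠ y.  All three conditions are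
-- compared with the absence of bad pairs.  If two factors of equal length differ in
-- weight by at least 2, then a bad pair is found inside them, so without bad pairs w
-- is balanced, and then moving from λ0… to λ1… cannot lower the weight.  Conversely a
-- bad pair makes the weight of a sliding window vary by 2, and recurrence turns this
-- into factors 0s and 1s′ with |0s|₁ > |1s′|₁.
-- Without bad pairs the right special factor of each length is unique, so that the
-- complexity grows by exactly 1; in a Sturmian word a shortest bad pair contradicts
-- the uniqueness of right special factors.
-- Consecutive factors that are at most two positions apart have nondecreasing weight,
-- and any two factors are joined by a chain of consecutive ones.  In the other
-- direction, if v and succ_w(v) differ in more places, then |prefix|₁ increases from v to
-- succ_w(v) at two lengths k < l; by balance the block between positions k and l then has
-- the same weight in every factor of length |v|, which makes w ultimately periodic.

open import Defs
open import Axiom.ExcludedMiddle using (ExcludedMiddle)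
open import Data.Empty using (⊥)
open import Data.Fin.Base using (Fin; zero; suc; toℕ)
open import Data.Fin.Patterns using (0F; 1F)
open import Data.Fin.Properties using (_≟_; pigeonhole; toℕ<n; toℕ-fromℕ<; toℕ-injective)
open import Data.List.Base using (List; []; _∷_; _∷ʳ_; length; lookup; applyUpTo; tabulate)
open import Data.List.Membership.Propositional using (_∈_)
open import Data.List.Membership.Propositional.Properties using (∈-tabulate⁺; ∈-tabulate⁻; ∈-lookup)
open import Data.List.Properties using (length-applyUpTo; lookup-applyUpTo; length-tabulate; ∷-injective)
open import Data.List.Relation.Binary.Prefix.Heterogeneous using (Prefix; []; _∷_)
import Data.List.Relation.Unary.Any as Any
open import Data.List.Relation.Unary.Any.Properties using (lookup-index)
import Data.List.Relation.Unary.All as All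
open import Data.List.Relation.Unary.AllPairs using ([]; _∷_)
open import Data.List.Relation.Unary.Unique.Propositional using (Unique)
open import Data.List.Relation.Unary.Unique.Propositional.Properties using (tabulate⁺)
open import Data.Nat.Base using (ℕ; zero; suc; _+_; _*_; _^_; _∸_; _≤_; _<_; z≤n; s≤s; z<s; s<s; _%_; _/_)
open import Data.Nat.DivMod using (m≡m%n+[m/n]*n; m%n<n; _mod_)
open import Data.Nat.Induction using (<-rec)
open import Data.Nat.Properties hiding (_≟_)
open import Data.Product.Base using (_×_; _,_; ∃-syntax; proj₁; proj₂)
open import Data.Sum.Base using (_⊎_; inj₁; inj₂; map)
open import Function.Base using (_∘_)
open import Function.Bundles using (_⇔_; mk⇔; Equivalence)
open import Level using (0ℓ)
open import Relation.Binary.PropositionalEquality using (_≡_; _≢_; refl; sym; trans; cong; cong₂; subst; subst₂; module ≡-Reasoning)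
open import Relation.Nullary.Decidable.Core using (Dec; yes; no)
open import Relation.Nullary.Negation.Core using (¬_; contradiction)

-- Letters and their contribution to weights and differences

binary : ∀ {x y z : Letter} → x ≢ z → y ≢ z → x ≡ y
binary {0F} {0F} x≢z y≢z = refl
binary {1F} {1F} x≢z y≢z = refl
binary {0F} {1F} {0F} x≢z y≢z = contradiction refl x≢z
binary {0F} {1F} {1F} x≢z y≢z = contradiction refl y≢z
binary {1F} {0F} {0F} x≢z y≢z = contradiction refl y≢z
binary {1F} {0F} {1F} x≢z y≢z = contradiction refl x≢z

δ : Letter → Letter → ℕ
δ 0F 0F = 0
δ 0F 1F = 1
δ 1F 0F = 1
δ 1F 1F = 0

δ≤1 : ∀ x y → δ x y ≤ 1
δ≤1 0F 0F = z≤n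
δ≤1 0F 1F = ≤-refl
δ≤1 1F 0F = ≤-refl
δ≤1 1F 1F = z≤n

δ-≡ : ∀ {x y} → x ≡ y → δ x y ≡ 0
δ-≡ {0F} refl = refl
δ-≡ {1F} refl = refl

∣∷∣₁ : ∀ x v → ∣ x ∷ v ∣₁ ≡ toℕ x + ∣ v ∣₁
∣∷∣₁ 0F v = refl
∣∷∣₁ 1F v = refl

differences-∷ : ∀ x y u v → differences (x ∷ u) (y ∷ v) ≡ δ x y + differences u v
differences-∷ 0F 0F u v = refl
differences-∷ 0F 1F u v = refl
differences-∷ 1F 0F u v = refl
differences-∷ 1F 1F u v = refl

-- Factors represented by the positions where they occur

module Windows (w : InfiniteWord) where

  infix 4 _≈[_]_

  -- Equality of factors is stated pointwise on positions, so later arguments shift indices instead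
  -- of splitting lists; being a record, it lets `n`, `i`, `j` be inferred.
  record _≈[_]_ (i n j : ℕ) : Set where
    constructor window
    field at : ∀ k → k < n → w (i + k) ≡ w (j + k)

  open _≈[_]_ public

  ≈-refl : ∀ {n i} → i ≈[ n ] i
  ≈-refl = window λ _ _ → refl

  ≈-sym : ∀ {n i j} → i ≈[ n ] j → j ≈[ n ] i
  ≈-sym e = window λ k k<n → sym (at e k k<n)

  ≈-trans : ∀ {n i j k} → i ≈[ n ] j → j ≈[ n ] k → i ≈[ n ] k
  ≈-trans e f = window λ k k<n → trans (at e k k<n) (at f k k<n)

  ≈-≤ : ∀ {m n i j} → m ≤ n → i ≈[ n ] j → i ≈[ m ] j
  ≈-≤ m≤n e = window λ k k<m → at e k (<-≤-trans k<m m≤n)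

  ≈-init : ∀ {n i j} → i ≈[ suc n ] j → i ≈[ n ] j
  ≈-init = ≈-≤ (n≤1+n _)

  ≈-last : ∀ {n i j} → i ≈[ suc n ] j → w (i + n) ≡ w (j + n)
  ≈-last {n} e = at e n (n<1+n n)

  ≈-head : ∀ {n i j} → i ≈[ suc n ] j → w i ≡ w j
  ≈-head {_} {i} {j} e =
    subst₂ (λ a b → w a ≡ w b) (+-identityʳ i) (+-identityʳ j) (at e 0 z<s)

  ≈-tail : ∀ {n i j} → i ≈[ suc n ] j → suc i ≈[ n ] suc j
  ≈-tail {_} {i} {j} e = window λ k k<n →
    subst₂ (λ a b → w a ≡ w b) (+-suc i k) (+-suc j k) (at e (suc k) (s<s k<n))

  ≈-cons : ∀ {n i j} → w i ≡ w j → suc i ≈[ n ] suc j → i ≈[ suc n ] j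
  ≈-cons {_} {i} {j} h e = window λ where
    zero    _         → subst₂ (λ a b → w a ≡ w b) (sym (+-identityʳ i)) (sym (+-identityʳ j)) h
    (suc k) (s<s k<n) → subst₂ (λ a b → w a ≡ w b) (sym (+-suc i k)) (sym (+-suc j k)) (at e k k<n)

  ≈-snoc : ∀ {n i j} → i ≈[ n ] j → w (i + n) ≡ w (j + n) → i ≈[ suc n ] j
  ≈-snoc {n} {i} {j} e l = window go
    where
    go : ∀ k → k < suc n → w (i + k) ≡ w (j + k)
    go k k<1+n with m<1+n⇒m<n∨m≡n k<1+n
    ... | inj₁ k<n  = at e k k<n
    ... | inj₂ refl = l

  block-suc : ∀ i n → block w i (suc n) ≡ w i ∷ block w (suc i) n
  block-suc i n = cong₂ _∷_ (cong w (+-identityʳ i)) (shift (λ k → cong w (+-suc i k)) n)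
    where
    shift : ∀ {f g : ℕ → Letter} → (∀ k → f k ≡ g k) → ∀ n → applyUpTo f n ≡ applyUpTo g n
    shift f≗g zero    = refl
    shift f≗g (suc n) = cong₂ _∷_ (f≗g 0) (shift (λ k → f≗g (suc k)) n)

  length-block : ∀ i n → length (block w i n) ≡ n
  length-block i = length-applyUpTo (λ k → w (i + k))

  ≈⇒block : ∀ n {i j} → i ≈[ n ] j → block w i n ≡ block w j n
  ≈⇒block zero    e = refl
  ≈⇒block (suc n) {i} {j} e rewrite block-suc i n | block-suc j n =
    cong₂ _∷_ (≈-head e) (≈⇒block n (≈-tail e))

  block⇒≈ : ∀ n {i j} → block w i n ≡ block w j n → i ≈[ n ] j
  block⇒≈ zero    eq = window λ _ ()
  block⇒≈ (suc n) {i} {j} eq rewrite block-suc i n | block-suc j n with ∷-injective eq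
  ... | h , t = ≈-cons h (block⇒≈ n t)

  block-fact : ∀ i n → Fact w (block w i n)
  block-fact i n = i , cong (block w i) (length-block i n)

  recurs : Recurrent w → ∀ i n N → ∃[ j ] N ≤ j × i ≈[ n ] j
  recurs rec i n N with rec (block w i n) (block-fact i n) N
  ... | j , N≤j , occ =
    j , N≤j , block⇒≈ n (sym (trans (cong (block w j) (sym (length-block i n))) occ))

  periodic-+* : ∀ {k p} → (∀ t → w (k + t) ≡ w (k + (p + t))) →
                ∀ q t → w (k + (t + q * p)) ≡ w (k + t)
  periodic-+* per zero    t = cong (λ z → w (_ + z)) (+-identityʳ t)
  periodic-+* {k} {p} per (suc q) t = begin
    w (k + (t + (p + q * p)))  ≡⟨ cong (λ z → w (k + z)) (sym (+-assoc t p (q * p))) ⟩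
    w (k + (t + p + q * p))    ≡⟨ periodic-+* per q (t + p) ⟩
    w (k + (t + p))            ≡⟨ cong (λ z → w (k + z)) (+-comm t p) ⟩
    w (k + (p + t))            ≡⟨ sym (per t) ⟩
    w (k + t)                  ∎
    where open ≡-Reasoning

  ultimatelyPeriodic : ∀ k p → (∀ t → w (k + t) ≡ w (k + (suc p + t))) → UltimatelyPeriodic w
  -- The head is `w (k + 0)`, unreduced, so that together with `u` it is definitionally
  -- `block w k (suc p)`.
  ultimatelyPeriodic k p per = k , w (k + 0) , u , go
    where
    u : FiniteWord
    u = applyUpTo (λ j → w (k + suc j)) p

    go : ∀ i → w (k + i) ≡ (w (k + 0) ∷ u ^ω) i
    go i = sym (begin
      lookup (block w k (suc p)) (i mod suc (length u))
        ≡⟨ lookup-applyUpTo (λ j → w (k + j)) (suc p) (i mod suc (length u)) ⟩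
      w (k + toℕ (i mod suc (length u)))
        ≡⟨ cong (λ z → w (k + z)) (toℕ-fromℕ< (m%n<n i (suc (length u)))) ⟩
      w (k + i % suc (length u))
        ≡⟨ cong (λ z → w (k + i % suc z)) (length-applyUpTo (λ j → w (k + suc j)) p) ⟩
      w (k + i % suc p)
        ≡⟨ sym (periodic-+* per (i / suc p) (i % suc p)) ⟩
      w (k + (i % suc p + i / suc p * suc p))
        ≡⟨ cong (λ z → w (k + z)) (sym (m≡m%n+[m/n]*n i (suc p))) ⟩
      w (k + i) ∎)
      where open ≡-Reasoning

  -- Right special factors and complexity

  RightSpecial : ℕ → ℕ → Set
  RightSpecial n p = ∃[ q ] p ≈[ n ] q × w (p + n) ≢ w (q + n)

  rs-tail : ∀ {n p} → RightSpecial (suc n) p → RightSpecial n (suc p)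
  rs-tail {n} {p} (q , e , ne) = suc q , ≈-tail e ,
    λ eq → ne (subst₂ (λ a b → w a ≡ w b) (sym (+-suc p n)) (sym (+-suc q n)) eq)

  rs-resp : ∀ {n p q} → p ≈[ n ] q → RightSpecial n p → RightSpecial n q
  rs-resp {n} {p} {q} e (r , f , ne) with w (q + n) ≟ w (p + n)
  ... | yes eq = r , ≈-trans (≈-sym e) f , λ eq′ → ne (trans (sym eq) eq′)
  ... | no  ne′ = p , ≈-sym e , ne′

  rs-avoiding : ∀ {n p} → RightSpecial n p → ∀ x → ∃[ q ] p ≈[ n ] q × w (q + n) ≢ x
  rs-avoiding {n} {p} (q , e , ne) x with w (p + n) ≟ x
  ... | no  ne′ = p , ≈-refl , ne′
  ... | yes eq  = q , e , λ eq′ → ne (trans eq (sym eq′))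

  rs-extending : ∀ {n p} → RightSpecial n p → ∀ x → ∃[ q ] p ≈[ n ] q × w (q + n) ≡ x
  rs-extending {n} {p} (q , e , ne) x with w (p + n) ≟ x
  ... | yes eq = p , ≈-refl , eq
  ... | no ne′ = q , e , binary (ne ∘ sym) (ne′ ∘ sym)

  ¬rs⇒≈-suc : ∀ {n p q} → ¬ RightSpecial n p → p ≈[ n ] q → p ≈[ suc n ] q
  ¬rs⇒≈-suc {n} {p} {q} ¬rs e with w (p + n) ≟ w (q + n)
  ... | yes eq = ≈-snoc e eq
  ... | no  ne = contradiction (q , e , ne) ¬rs

  -- Without a right special window between two occurrences of the same window,
  -- the letters after the second occurrence are forced to repeat those after the first.
  deterministic⇒periodic : ∀ n k p → k ≈[ n ] k + suc p →
    (∀ t → t ≤ p → ¬ RightSpecial n (k + t)) → UltimatelyPeriodic w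
  deterministic⇒periodic n k p e nrs = ultimatelyPeriodic (k + n) p per
    where
    P : ℕ → Set
    P t = k + t ≈[ n ] k + (suc p + t) × ¬ RightSpecial n (k + t)

    ¬rs-at : ∀ t → (∀ {s} → s < t → P s) → ¬ RightSpecial n (k + t)
    ¬rs-at t ih with t <? suc p
    ... | yes t<1+p = nrs t (≤-pred t<1+p)
    -- After the first period the window at `k + t` repeats the one `suc p` earlier, which is
    -- already known not to be right special.
    ... | no  t≮1+p = λ rs → proj₂ prev (rs-resp back rs)
      where
      s = t ∸ suc p
      eq : suc p + s ≡ t
      eq = m+[n∸m]≡n (≮⇒≥ t≮1+p)
      prev : P s
      prev = ih (subst (s <_) eq (m<n+m s z<s))
      back : k + t ≈[ n ] k + s
      back = subst (λ z → k + z ≈[ n ] k + s) eq (≈-sym (proj₁ prev))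

    all : ∀ t → P t
    all = <-rec P λ
      { zero ih → subst₂ (λ a b → a ≈[ n ] k + b) (sym (+-identityʳ k)) (sym (+-identityʳ (suc p))) e
                , ¬rs-at 0 ih
      ; (suc t) ih → let (f , ¬rs) = ih (n<1+n t) in
          subst₂ (λ a b → a ≈[ n ] b) (sym (+-suc k t))
            (trans (sym (+-suc k (suc p + t))) (cong (k +_) (sym (+-suc (suc p) t))))
            (≈-tail (¬rs⇒≈-suc ¬rs f))
          , ¬rs-at (suc t) ih
      }

    swap : ∀ a b c → a + b + c ≡ a + c + b
    swap a b c = trans (+-assoc a b c) (trans (cong (a +_) (+-comm b c)) (sym (+-assoc a c b)))

    per : ∀ t → w (k + n + t) ≡ w (k + n + (suc p + t))
    per t = let (f , ¬rs) = all t in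
      subst₂ (λ a b → w a ≡ w b) (swap k t n) (swap k (suc p + t) n) (≈-last (¬rs⇒≈-suc ¬rs f))

  -- The factors xux at i and yuy at j, where |u| = ℓ and x ≠ y.
  record Bad (ℓ i j : ℕ) : Set where
    field
      different : w i ≢ w j
      inner     : suc i ≈[ ℓ ] suc j
      closeˡ    : w (suc i + ℓ) ≡ w i
      closeʳ    : w (suc j + ℓ) ≡ w j

  Bad-sym : ∀ {ℓ i j} → Bad ℓ i j → Bad ℓ j i
  Bad-sym b = record
    { different = different ∘ sym ; inner = ≈-sym inner ; closeˡ = closeʳ ; closeʳ = closeˡ }
    where open Bad b

  NoBad : Set
  NoBad = ∀ ℓ i j → ¬ Bad ℓ i j

  RsUnique : ℕ → Set
  RsUnique n = ∀ p q → RightSpecial n p → RightSpecial n q → p ≈[ n ] q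

  -- Induction on the length: tails of right special factors are right special, hence equal to a
  -- common u. If the first letters x, y differed, then xu and yu, each being extendable by both
  -- letters, would give the bad pair xux, yuy.
  NoBad⇒RsUnique : NoBad → ∀ n → RsUnique n
  NoBad⇒RsUnique nb zero    p q _ _ = window λ _ ()
  NoBad⇒RsUnique nb (suc n) p q rp rq with w p ≟ w q
  ... | yes eq = ≈-cons eq (NoBad⇒RsUnique nb n (suc p) (suc q) (rs-tail rp) (rs-tail rq))
  ... | no  ne with rs-extending rp (w p) | rs-extending rq (w q)
  ... | p′ , ep , lp | q′ , eq , lq = contradiction bad (nb n p′ q′)
    where
    bad : Bad n p′ q′
    bad = record
      { different = λ e → ne (trans (≈-head ep) (trans e (sym (≈-head eq))))
      ; inner = ≈-trans (≈-tail (≈-sym ep))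
                  (≈-trans (NoBad⇒RsUnique nb n (suc p) (suc q) (rs-tail rp) (rs-tail rq)) (≈-tail eq))
      ; closeˡ = trans (cong w (sym (+-suc p′ n))) (trans lp (≈-head ep))
      ; closeʳ = trans (cong w (sym (+-suc q′ n))) (trans lq (≈-head eq))
      }

  -- The complexity of `w` at `n` is `m`, witnessed by one chosen occurrence of each factor of
  -- length `n`.
  record Enumerated (n m : ℕ) : Set where
    field
      pos    : Fin m → ℕ
      unique : ∀ a b → pos a ≈[ n ] pos b → a ≡ b
      index  : ℕ → Fin m
      covers : ∀ i → i ≈[ n ] pos (index i)

  Sturmian⇒Enumerated : Sturmian w → ∀ n → Enumerated n (suc n)
  Sturmian⇒Enumerated st n with st n
  ... | vs , len , uniq , iff = subst (Enumerated n) len (record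
      { pos = pos′
      ; unique = λ a b e → lookup-injective uniq a b
          (trans (sym (occurs a)) (trans (≈⇒block n e) (occurs b)))
      ; index = λ i → Any.index (mem i)
      ; covers = λ i → block⇒≈ n (trans (lookup-index (mem i)) (sym (occurs (Any.index (mem i)))))
      })
    where
    lookup-injective : ∀ {xs : List FiniteWord} → Unique xs → ∀ a b → lookup xs a ≡ lookup xs b → a ≡ b
    lookup-injective (_ ∷ _) zero zero _ = refl
    lookup-injective {x ∷ xs} (px ∷ _) zero (suc b) eq = contradiction eq (All.lookup px (∈-lookup b))
    lookup-injective {x ∷ xs} (px ∷ _) (suc a) zero eq = contradiction (sym eq) (All.lookup px (∈-lookup a))
    lookup-injective (_ ∷ u) (suc a) (suc b) eq = cong suc (lookup-injective u a b eq)

    found : ∀ a → Fact w (lookup vs a) × length (lookup vs a) ≡ n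
    found a = Equivalence.to (iff (lookup vs a)) (∈-lookup a)

    pos′ : Fin (length vs) → ℕ
    pos′ a = proj₁ (proj₁ (found a))

    occurs : ∀ a → block w (pos′ a) n ≡ lookup vs a
    occurs a with found a
    ... | (i , occ) , refl = occ

    mem : ∀ i → block w i n ∈ vs
    mem i = Equivalence.from (iff (block w i n)) (block-fact i n , length-block i n)

  Enumerated⇒Sturmian : (∀ n → Enumerated n (suc n)) → Sturmian w
  Enumerated⇒Sturmian enum n =
    tabulate word , length-tabulate word , tabulate⁺ (λ {a} {b} e → unique a b (block⇒≈ n e)) ,
    λ v → mk⇔ (to v) (from v)
    where
    open Enumerated (enum n)

    word : Fin (suc n) → FiniteWord
    word a = block w (pos a) n

    to : ∀ v → v ∈ tabulate word → Fact w v × length v ≡ n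
    to v v∈ with ∈-tabulate⁻ {f = word} v∈
    ... | a , refl = block-fact (pos a) n , length-block (pos a) n

    from : ∀ v → Fact w v × length v ≡ n → v ∈ tabulate word
    from v ((i , occ) , refl) =
      subst (_∈ tabulate word) (trans (sym (≈⇒block n (covers i))) occ) (∈-tabulate⁺ {f = word} (index i))

  -- Each chosen occurrence is prolonged by the letter that follows it. A factor followed by the
  -- other letter is right special, so it is the one at `r`; its second extension, at `r′`, is the
  -- only new factor.
  Enumerated-suc : ∀ {n m r} → RsUnique n → RightSpecial n r → Enumerated n m → Enumerated (suc n) (suc m)
  Enumerated-suc {n} {m} {r} rsu rs en with rs-avoiding rs (w (Enumerated.pos en (Enumerated.index en r) + n))
  ... | r′ , r≈r′ , avoids = record
    { pos = pos′ ; unique = unique′ ; index = λ i → proj₁ (find i) ; covers = λ i → proj₂ (find i) }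
    where
    open Enumerated en
    pos′ : Fin (suc m) → ℕ
    pos′ zero    = r′
    pos′ (suc a) = pos a

    index-≈ : ∀ {i a} → i ≈[ n ] pos a → index i ≡ a
    index-≈ {i} e = unique _ _ (≈-trans (≈-sym (covers i)) e)

    clash : ∀ a → ¬ r′ ≈[ suc n ] pos a
    clash a e = avoids (trans (≈-last e)
      (cong (λ b → w (pos b + n)) (sym (index-≈ (≈-trans r≈r′ (≈-init e))))))

    unique′ : ∀ a b → pos′ a ≈[ suc n ] pos′ b → a ≡ b
    unique′ zero    zero    e = refl
    unique′ zero    (suc b) e = contradiction e (clash b)
    unique′ (suc a) zero    e = contradiction (≈-sym e) (clash a)
    unique′ (suc a) (suc b) e = cong suc (unique a b (≈-init e))

    find : ∀ i → ∃[ a ] i ≈[ suc n ] pos′ a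
    find i with w (i + n) ≟ w (pos (index i) + n)
    ... | yes eq = suc (index i) , ≈-snoc (covers i) eq
    ... | no  ne = zero , ≈-snoc (≈-trans i≈r r≈r′)
                     (binary ne λ eq → avoids
                       (trans eq (cong (λ b → w (pos b + n)) (index-≈ (≈-trans i≈r (covers r))))))
      where
      i≈r : i ≈[ n ] r
      i≈r = rsu i r (pos (index i) , covers i , ne) rs

  -- Two distinct right special factors would both have a second extension, at `p′` and `q′`; with
  -- the `m` prolonged representatives this makes `m + 2` factors of length `n + 1`, one too many.
  Enumerated⇒RsUnique : ∀ {n m} → Enumerated n m → Enumerated (suc n) (suc m) →
                        ∀ p q → RightSpecial n p → RightSpecial n q → ¬ ¬ p ≈[ n ] q
  Enumerated⇒RsUnique {n} {m} en en′ p q rp rq p≉q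
    with rs-avoiding rp (w (Enumerated.pos en (Enumerated.index en p) + n))
       | rs-avoiding rq (w (Enumerated.pos en (Enumerated.index en q) + n))
  ... | p′ , ep , np | q′ , eq , nq = collide (pigeonhole ≤-refl (λ a → Enumerated.index en′ (place a)))
    where
    open Enumerated en
    place : Fin (suc (suc m)) → ℕ
    place zero          = p′
    place (suc zero)    = q′
    place (suc (suc a)) = pos a

    clash : ∀ {r r′} → r ≈[ n ] r′ → w (r′ + n) ≢ w (pos (index r) + n) → ∀ a → ¬ r′ ≈[ suc n ] pos a
    clash {r} e ne a f = ne (trans (≈-last f)
      (cong (λ b → w (pos b + n)) (unique _ _ (≈-trans (≈-sym (≈-trans e (≈-init f))) (covers r)))))

    distinct : ∀ a b → toℕ a < toℕ b → ¬ place a ≈[ suc n ] place b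
    distinct zero          (suc zero)    _ e = p≉q (≈-trans ep (≈-trans (≈-init e) (≈-sym eq)))
    distinct zero          (suc (suc b)) _ e = clash ep np b e
    distinct (suc zero)    (suc (suc b)) _ e = clash eq nq b e
    distinct (suc zero)    (suc zero)    (s<s ()) e
    distinct (suc (suc a)) (suc zero)    (s<s ()) e
    distinct (suc (suc a)) (suc (suc b)) a<b e with unique a b (≈-init e)
    ... | refl = <-irrefl refl a<b

    collide : ¬ (∃[ a ] ∃[ b ] toℕ a < toℕ b × Enumerated.index en′ (place a) ≡ Enumerated.index en′ (place b))
    collide (a , b , a<b , eq′) = distinct a b a<b
      (≈-trans (Enumerated.covers en′ (place a))
        (subst (λ c → Enumerated.pos en′ c ≈[ suc n ] place b) (sym eq′)
          (≈-sym (Enumerated.covers en′ (place b)))))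

  -- Otherwise every window of length `n` determines the next letter, and by recurrence the initial
  -- window returns. The bound 1 on the return position makes the period positive.
  ∃-rightSpecial : ExcludedMiddle 0ℓ → Recurrent w → Aperiodic w → ∀ n → ∃[ p ] RightSpecial n p
  ∃-rightSpecial em rec ap n with em {∃[ p ] RightSpecial n p}
  ... | yes rs = rs
  ... | no ¬rs with recurs rec 0 n 1
  ... | suc p , _ , e = contradiction (deterministic⇒periodic n 0 p e (λ t _ rs → ¬rs (t , rs))) ap

  NoBad⇒Sturmian : ExcludedMiddle 0ℓ → Recurrent w → Aperiodic w → NoBad → Sturmian w
  NoBad⇒Sturmian em rec ap nb = Enumerated⇒Sturmian enum
    where
    enum : ∀ n → Enumerated n (suc n)
    enum zero    = record
      { pos = λ _ → 0 ; unique = λ { zero zero _ → refl } ; index = λ _ → zero ; covers = λ _ → window λ _ () }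
    enum (suc n) = Enumerated-suc (NoBad⇒RsUnique nb n) (proj₂ (∃-rightSpecial em rec ap n)) (enum n)

  -- Let xux occur at `i` and yuy at `j`. If yu starts again `suc d` letters into xux, then ux has
  -- period `suc d`. Moving the last x back by one period gives a prefix xu′x of xux, and yuy has
  -- the suffix yu′y.
  shorten-Bad : ∀ {ℓ i j} → Bad ℓ i j → ∀ d ℓ′ → suc d + ℓ′ ≡ ℓ → i + suc d ≈[ suc ℓ ] j →
                Bad ℓ′ i (j + suc d)
  shorten-Bad {i = i} {j} b d ℓ′ refl e = record
    { different = λ eq → different (trans eq wj)
    ; inner  = window λ k k<ℓ′ → trans (sym (overlaps k (<-trans k<ℓ′ (m<n+m ℓ′ z<s)))) (shifted k k<ℓ′)
    ; closeˡ = trans (sym (overlaps ℓ′ (m<n+m ℓ′ z<s)))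
                 (trans (cong (λ z → w (suc z)) (+-assoc i (suc d) ℓ′)) closeˡ)
    ; closeʳ = trans (trans (cong (λ z → w (suc z)) (+-assoc j (suc d) ℓ′)) closeʳ) (sym wj)
    }
    where
    open Bad b
    shifted : ∀ k → k < ℓ′ → w (suc (i + suc d) + k) ≡ w (suc (j + suc d) + k)
    shifted k k<ℓ′ = subst₂ (λ a c → w (suc a) ≡ w (suc c)) (sym (+-assoc i (suc d) k)) (sym (+-assoc j (suc d) k))
      (at inner (suc d + k) (+-monoʳ-< (suc d) k<ℓ′))
    overlaps : ∀ k → k < suc d + ℓ′ → w (suc (i + suc d) + k) ≡ w (suc i + k)
    overlaps k k<ℓ = trans (at (≈-tail e) k k<ℓ) (sym (at inner k k<ℓ))
    wj : w (j + suc d) ≡ w j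
    wj = begin
      w (j + suc d)   ≡⟨ cong w (+-suc j d) ⟩
      w (suc j + d)   ≡⟨ sym (at inner d (s≤s (m≤m+n d ℓ′))) ⟩
      w (suc i + d)   ≡⟨ cong w (sym (+-suc i d)) ⟩
      w (i + suc d)   ≡⟨ ≈-head e ⟩
      w j             ∎
      where open ≡-Reasoning

  -- If 1u1 and 0u0 occur with u as short as possible and 0u is the right special
  -- word of its length, then 0u cannot begin within the |u| + 1 letters after the
  -- start of 1u1, and the pigeonhole principle makes the word periodic before it does.
  minimal-Bad-impossible : ∀ {ℓ i j} → Aperiodic w → Enumerated (suc ℓ) (suc (suc ℓ)) →
    (∀ ℓ′ → ℓ′ < ℓ → ∀ i j → ¬ Bad ℓ′ i j) → Bad ℓ i j →
    ¬ (∀ p → RightSpecial (suc ℓ) p → p ≈[ suc ℓ ] j)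
  minimal-Bad-impossible {ℓ} {i} {j} ap en min b only =
    collide (pigeonhole ≤-refl (λ a → index (place a)))
    where
    open Bad b
    open Enumerated en

    -- These are `ℓ + 3` positions, against only `ℓ + 2` factors of length `ℓ + 1`: `j` itself and
    -- the positions from `i` to `i + suc ℓ`.
    place : Fin (suc (suc (suc ℓ))) → ℕ
    place zero    = j
    place (suc a) = i + toℕ a

    -- At `d = 0` and `d = suc ℓ` the window starts with one of the two outer letters of the word at
    -- `i`, which differ from `w j`; in between, a shorter bad pair would arise.
    avoids-j : ∀ d → d ≤ suc ℓ → ¬ i + d ≈[ suc ℓ ] j
    avoids-j zero    _ e = different (trans (cong w (sym (+-identityʳ i))) (≈-head e))
    avoids-j (suc d) (s≤s d≤ℓ) e with m≤n⇒m<n∨m≡n d≤ℓ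
    ... | inj₁ d<ℓ  = min (ℓ ∸ suc d) (subst (ℓ ∸ suc d <_) (m+[n∸m]≡n d<ℓ) (m<n+m _ z<s)) i (j + suc d)
                        (shorten-Bad b d (ℓ ∸ suc d) (m+[n∸m]≡n d<ℓ) e)
    ... | inj₂ refl = different (trans (sym closeˡ) (trans (cong w (sym (+-suc i d))) (≈-head e)))

    repeated : ∀ a b → a < b → b ≤ suc ℓ → ¬ i + a ≈[ suc ℓ ] i + b
    repeated a b a<b b≤ e with m≤n⇒∃[o]m+o≡n a<b
    ... | p , refl = ap (deterministic⇒periodic (suc ℓ) (i + a) p
            (subst (i + a ≈[ suc ℓ ]_) (trans (cong (i +_) (sym (+-suc a p))) (sym (+-assoc i a (suc p)))) e)
            λ t t≤p rs → avoids-j (a + t) (≤-trans (+-monoʳ-≤ a t≤p) (≤-trans (n≤1+n _) b≤))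
              (subst (_≈[ suc ℓ ] j) (+-assoc i a t) (only _ rs)))

    distinct : ∀ a b → toℕ a < toℕ b → ¬ place a ≈[ suc ℓ ] place b
    distinct zero    (suc b) _         e = avoids-j (toℕ b) (≤-pred (toℕ<n b)) (≈-sym e)
    distinct (suc a) (suc b) (s<s a<b) e = repeated (toℕ a) (toℕ b) a<b (≤-pred (toℕ<n b)) e

    collide : ¬ (∃[ a ] ∃[ b ] toℕ a < toℕ b × index (place a) ≡ index (place b))
    collide (a , b , a<b , eq) = distinct a b a<b
      (≈-trans (covers (place a)) (subst (λ c → pos c ≈[ suc ℓ ] place b) (sym eq) (≈-sym (covers (place b)))))

  -- Strong induction on |u|. In a bad pair u is followed by both letters, so it is the tail of the
  -- right special factor of length |u| + 1. That factor is therefore xu or yu, and `Bad-sym`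
  -- exchanges the two cases.
  Sturmian⇒NoBad : ExcludedMiddle 0ℓ → Recurrent w → Aperiodic w → Sturmian w → NoBad
  Sturmian⇒NoBad em rec ap st = λ ℓ → <-rec (λ ℓ → ∀ i j → ¬ Bad ℓ i j) step ℓ
    where
    rsu : ∀ n → RsUnique n
    rsu n p q rp rq with em {p ≈[ n ] q}
    ... | yes e = e
    ... | no ne = contradiction ne
            (Enumerated⇒RsUnique (Sturmian⇒Enumerated st n) (Sturmian⇒Enumerated st (suc n)) p q rp rq)

    step : ∀ ℓ → (∀ {ℓ′} → ℓ′ < ℓ → ∀ i j → ¬ Bad ℓ′ i j) → ∀ i j → ¬ Bad ℓ i j
    step ℓ ih i j b with ∃-rightSpecial em rec ap (suc ℓ)
    ... | r , rs = case-r
      where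
      open Bad b
      rs-i : RightSpecial ℓ (suc i)
      rs-i = suc j , inner , λ eq → different (trans (sym closeˡ) (trans eq closeʳ))
      r≈i : suc r ≈[ ℓ ] suc i
      r≈i = rsu ℓ _ _ (rs-tail rs) rs-i
      impossible : ∀ {i j} → Bad ℓ i j → r ≈[ suc ℓ ] j → ⊥
      impossible b e = minimal-Bad-impossible ap (Sturmian⇒Enumerated st (suc ℓ)) (λ _ lt → ih lt) b
        (λ p rp → ≈-trans (rsu (suc ℓ) p r rp rs) e)
      case-r : ⊥
      case-r with w r ≟ w j
      ... | yes eq = impossible b (≈-cons eq (≈-trans r≈i inner))
      ... | no  ne = impossible (Bad-sym b) (≈-cons (binary ne different) r≈i)

  -- Weights and balance

  weight : ℕ → ℕ → ℕ
  weight i zero    = 0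
  weight i (suc n) = toℕ (w i) + weight (suc i) n

  ∣block∣₁ : ∀ i n → ∣ block w i n ∣₁ ≡ weight i n
  ∣block∣₁ i zero    = refl
  ∣block∣₁ i (suc n) = begin
    ∣ block w i (suc n) ∣₁           ≡⟨ cong ∣_∣₁ (block-suc i n) ⟩
    ∣ w i ∷ block w (suc i) n ∣₁     ≡⟨ ∣∷∣₁ (w i) (block w (suc i) n) ⟩
    toℕ (w i) + ∣ block w (suc i) n ∣₁  ≡⟨ cong (toℕ (w i) +_) (∣block∣₁ (suc i) n) ⟩
    weight i (suc n)                 ∎
    where open ≡-Reasoning

  weight-+ : ∀ i m n → weight i (m + n) ≡ weight i m + weight (i + m) n
  weight-+ i zero    n = cong (λ z → weight z n) (sym (+-identityʳ i))
  weight-+ i (suc m) n = begin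
    toℕ (w i) + weight (suc i) (m + n)
      ≡⟨ cong (toℕ (w i) +_) (weight-+ (suc i) m n) ⟩
    toℕ (w i) + (weight (suc i) m + weight (suc i + m) n)
      ≡⟨ sym (+-assoc (toℕ (w i)) (weight (suc i) m) (weight (suc i + m) n)) ⟩
    toℕ (w i) + weight (suc i) m + weight (suc i + m) n
      ≡⟨ cong (λ z → toℕ (w i) + weight (suc i) m + weight z n) (sym (+-suc i m)) ⟩
    toℕ (w i) + weight (suc i) m + weight (i + suc m) n ∎
    where open ≡-Reasoning

  weight-snoc : ∀ i n → weight i (suc n) ≡ weight i n + toℕ (w (i + n))
  weight-snoc i n = begin
    weight i (suc n)                      ≡⟨ cong (weight i) (+-comm 1 n) ⟩
    weight i (n + 1)                      ≡⟨ weight-+ i n 1 ⟩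
    weight i n + (toℕ (w (i + n)) + 0)    ≡⟨ cong (weight i n +_) (+-identityʳ _) ⟩
    weight i n + toℕ (w (i + n))          ∎
    where open ≡-Reasoning

  weight-≈ : ∀ n {i j} → i ≈[ n ] j → weight i n ≡ weight j n
  weight-≈ zero    e = refl
  weight-≈ (suc n) e = cong₂ _+_ (cong toℕ (≈-head e)) (weight-≈ n (≈-tail e))

  -- Sliding the window by one drops a letter and gains the one `suc p` further on; if the weight
  -- does not change, these letters agree.
  constantWeight⇒periodic : ∀ k p {c} → (∀ t → weight (t + k) (suc p) ≡ c) → UltimatelyPeriodic w
  constantWeight⇒periodic k p {c} const = ultimatelyPeriodic k p λ t →
    subst₂ (λ a b → w a ≡ w b) (+-comm t k) (reorder t)
      (toℕ-injective (+-cancelˡ-≡ c _ _ (begin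
        c + toℕ (w (t + k))                                ≡⟨ +-comm c _ ⟩
        toℕ (w (t + k)) + c                                ≡⟨ cong (toℕ (w (t + k)) +_) (sym (const (suc t))) ⟩
        weight (t + k) (suc (suc p))                       ≡⟨ weight-snoc (t + k) (suc p) ⟩
        weight (t + k) (suc p) + toℕ (w (t + k + suc p))   ≡⟨ cong (_+ _) (const t) ⟩
        c + toℕ (w (t + k + suc p))                        ∎)))
    where
    open ≡-Reasoning
    reorder : ∀ t → t + k + suc p ≡ k + (suc p + t)
    reorder t = trans (cong (_+ suc p) (+-comm t k)) (trans (+-assoc k t (suc p)) (cong (k +_) (+-comm t (suc p))))

  Balanced : Set
  Balanced = ∀ n i j → weight i n ≤ suc (weight j n)

  -- Scanning two windows from the left while recording whether the last
  -- disagreement was 1 against 0: two such disagreements in a row form a bad pair.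
  NoBad⇒Balanced : NoBad → Balanced
  NoBad⇒Balanced nb n i j = ≮⇒≥ (scan n i j)
    where
    scan : ∀ n i j → ¬ (2 + weight j n ≤ weight i n)
    -- The disagreement at `i`, `j`, followed by `ℓ` equal letters, has supplied one unit of the
    -- excess; the other must come from the remaining `n` letters. A disagreement 0 against 1
    -- cancels that unit and leads back to `scan`.
    pending : ∀ n ℓ i j → w i ≡ 1F → w j ≡ 0F → suc i ≈[ ℓ ] suc j →
              ¬ (1 + weight (suc j + ℓ) n ≤ weight (suc i + ℓ) n)

    scan zero    i j ()
    scan (suc n) i j le with w i in wi | w j in wj
    ... | 0F | 0F = scan n (suc i) (suc j) le
    ... | 0F | 1F = scan n (suc i) (suc j) (≤-trans (n≤1+n _) le)
    ... | 1F | 1F = scan n (suc i) (suc j) (≤-pred le)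
    ... | 1F | 0F = pending n 0 i j wi wj (window λ _ ())
                      (subst₂ (λ a b → 1 + weight b n ≤ weight a n)
                        (cong suc (sym (+-identityʳ i))) (cong suc (sym (+-identityʳ j))) (≤-pred le))

    pending zero    ℓ i j wi wj e ()
    pending (suc n) ℓ i j wi wj e le with w (suc i + ℓ) in wi′ | w (suc j + ℓ) in wj′
    ... | 0F | 1F = scan n _ _ le
    ... | 1F | 0F = nb ℓ i j (record
      { different = λ eq → contradiction (trans (sym wi) (trans eq wj)) λ ()
      ; inner = e ; closeˡ = trans wi′ (sym wi) ; closeʳ = trans wj′ (sym wj) })
    ... | 0F | 0F = pending n (suc ℓ) i j wi wj (≈-snoc e (trans wi′ (sym wj′)))
                      (subst₂ (λ a b → 1 + weight b n ≤ weight a n)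
                        (cong suc (sym (+-suc i ℓ))) (cong suc (sym (+-suc j ℓ))) le)
    ... | 1F | 1F = pending n (suc ℓ) i j wi wj (≈-snoc e (trans wi′ (sym wj′)))
                      (subst₂ (λ a b → 1 + weight b n ≤ weight a n)
                        (cong suc (sym (+-suc i ℓ))) (cong suc (sym (+-suc j ℓ))) (≤-pred le))

  -- Lexicographic order and monotone weights

  infix 4 _<[_]_

  data _<[_]_ (i : ℕ) : ℕ → ℕ → Set where
    here  : ∀ {n j} → w i ≡ 0F → w j ≡ 1F → i <[ suc n ] j
    there : ∀ {n j} → w i ≡ w j → suc i <[ n ] suc j → i <[ suc n ] j

  prepend : ∀ {n i j} → w i ≡ w j → suc i ≈[ n ] suc j ⊎ suc i <[ n ] suc j ⊎ suc j <[ n ] suc i →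
            i ≈[ suc n ] j ⊎ i <[ suc n ] j ⊎ j <[ suc n ] i
  prepend h = map (≈-cons h) (map (there h) (there (sym h)))

  trichotomy : ∀ n i j → i ≈[ n ] j ⊎ i <[ n ] j ⊎ j <[ n ] i
  trichotomy zero    i j = inj₁ (window λ _ ())
  trichotomy (suc n) i j with w i in wi | w j in wj
  ... | 0F | 1F = inj₂ (inj₁ (here wi wj))
  ... | 1F | 0F = inj₂ (inj₂ (here wj wi))
  ... | 0F | 0F = prepend (trans wi (sym wj)) (trichotomy n (suc i) (suc j))
  ... | 1F | 1F = prepend (trans wi (sym wj)) (trichotomy n (suc i) (suc j))

  first-difference : ∀ {n i j} → i <[ n ] j →
    ∃[ k ] k < n × i ≈[ k ] j × w (i + k) ≡ 0F × w (j + k) ≡ 1F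
  first-difference {i = i} {j} (here p q) =
    0 , z<s , window (λ _ ()) , trans (cong w (+-identityʳ i)) p , trans (cong w (+-identityʳ j)) q
  first-difference {i = i} {j} (there h lt) with first-difference lt
  ... | k , k<n , e , p , q =
    suc k , s<s k<n , ≈-cons h e , trans (cong w (+-suc i k)) p , trans (cong w (+-suc j k)) q

  lex⇒< : ∀ n {i j} → block w i n <lex block w j n → i <[ n ] j
  lex⇒< n {i} {j} (_ , l , a , b , a<b , p , q) = go n l p q
    where
    go : ∀ n {i j} l → Prefix _≡_ (l ∷ʳ a) (block w i n) → Prefix _≡_ (l ∷ʳ b) (block w j n) → i <[ n ] j
    go zero    []      ()
    go zero    (_ ∷ _) ()
    go (suc n) {i} {j} l p q rewrite block-suc i n | block-suc j n with l | p | q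
    ... | []    | eq ∷ _ | eq′ ∷ _ = bits a b a<b eq eq′
      where
      bits : ∀ a b → toℕ a < toℕ b → a ≡ w i → b ≡ w j → i <[ suc n ] j
      bits 0F 1F _ eq eq′ = here (sym eq) (sym eq′)
      bits 1F 1F (s<s ())
    ... | _ ∷ l | eq ∷ p | eq′ ∷ q = there (trans (sym eq) eq′) (go n l p q)

  <⇒lex : ∀ n {i j} → i <[ n ] j → block w i n <lex block w j n
  <⇒lex n {i} {j} lt = trans (length-block i n) (sym (length-block j n)) , split n lt
    where
    split : ∀ n {i j} → i <[ n ] j → ∃[ l ] ∃[ a ] ∃[ b ] toℕ a < toℕ b ×
            Prefix _≡_ (l ∷ʳ a) (block w i n) × Prefix _≡_ (l ∷ʳ b) (block w j n)
    split (suc n) {i} {j} (here p q) rewrite block-suc i n | block-suc j n =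
      [] , 0F , 1F , z<s , sym p ∷ [] , sym q ∷ []
    split (suc n) {i} {j} (there h lt) rewrite block-suc i n | block-suc j n with split n lt
    ... | l , a , b , a<b , p , q = w i ∷ l , a , b , a<b , refl ∷ p , h ∷ q

  Monotone : Set
  Monotone = ∀ n i j → i <[ n ] j → weight i n ≤ weight j n

  Monotone⇒LexMonotoneWeight : Monotone → LexMonotoneWeight w
  Monotone⇒LexMonotoneWeight mono v v′ (i , occ) (j , occ′) len lt =
    subst₂ (λ x y → ∣ x ∣₁ ≤ ∣ y ∣₁) occ occ″
      (subst₂ _≤_ (sym (∣block∣₁ i n)) (sym (∣block∣₁ j n))
        (mono n i j (lex⇒< n (subst₂ _<lex_ (sym occ) (sym occ″) lt))))
    where
    n = length v
    occ″ : block w j n ≡ v′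
    occ″ = trans (cong (block w j) len) occ′

  LexMonotoneWeight⇒Monotone : LexMonotoneWeight w → Monotone
  LexMonotoneWeight⇒Monotone lm n i j lt =
    subst₂ _≤_ (∣block∣₁ i n) (∣block∣₁ j n)
      (lm _ _ (block-fact i n) (block-fact j n) (trans (length-block i n) (sym (length-block j n))) (<⇒lex n lt))

  -- After the common prefix comes 0 against 1; by balance the letters that follow can lose at most
  -- the one unit gained there. All prefix lengths are covered because prefix weights are later
  -- compared at two of them.
  prefix-monotone : Balanced → ∀ {n i j l} → l ≤ n → i <[ n ] j → weight i l ≤ weight j l
  prefix-monotone bal {l = zero}  l≤n lt = z≤n
  prefix-monotone bal {i = i} {j} {suc l} l≤n (here p q) =
    subst₂ (λ a b → toℕ a + weight (suc i) l ≤ toℕ b + weight (suc j) l) (sym p) (sym q) (bal l (suc i) (suc j))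
  prefix-monotone bal {j = j} {suc l} (s≤s l≤n) (there h lt) =
    +-mono-≤ (≤-reflexive (cong toℕ h)) (prefix-monotone bal l≤n lt)

  NoBad⇒Monotone : NoBad → Monotone
  NoBad⇒Monotone nb n i j = prefix-monotone (NoBad⇒Balanced nb) ≤-refl

  -- Sliding a window along the word

  crossing : ∀ {P : ℕ → Set} → (∀ k → Dec (P k)) → ∀ {i j} → i ≤ j → ¬ P i → P j → ∃[ k ] ¬ P k × P (suc k)
  crossing {P} P? {i} i≤j ¬pi pj with m≤n⇒∃[o]m+o≡n i≤j
  ... | d , refl = go d pj
    where
    go : ∀ d → P (i + d) → ∃[ k ] ¬ P k × P (suc k)
    go zero    p = contradiction (subst P (+-identityʳ i) p) ¬pi
    go (suc d) p with P? (i + d)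
    ... | yes q = go d q
    ... | no ¬q = i + d , ¬q , subst P (+-suc i d) p

  bit≤1 : ∀ i → toℕ (w i) ≤ 1
  bit≤1 i = ≤-pred (toℕ<n (w i))

  -- If the dropped letter were 1, the single letter gained at the other end could at most make up
  -- for it.
  rising : ∀ {a n} → weight a n < weight (suc a) n → w a ≡ 0F
  rising {a} {n} lt with w a in wa
  ... | 0F = refl
  ... | 1F = contradiction lt (≤⇒≯ (≤-pred (begin
    suc (weight (suc a) n)         ≡⟨ cong (λ z → toℕ z + weight (suc a) n) (sym wa) ⟩
    weight a (suc n)               ≡⟨ weight-snoc a n ⟩
    weight a n + toℕ (w (a + n))   ≤⟨ +-monoʳ-≤ (weight a n) (bit≤1 (a + n)) ⟩
    weight a n + 1                 ≡⟨ +-comm _ 1 ⟩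
    suc (weight a n)               ∎)))
    where open ≤-Reasoning

  falling : ∀ {a n} → weight (suc a) n < weight a n → w a ≡ 1F
  falling {a} {n} lt with w a in wa
  ... | 1F = refl
  ... | 0F = contradiction lt (≤⇒≯ (begin
    weight a n                     ≤⟨ m≤m+n _ _ ⟩
    weight a n + toℕ (w (a + n))   ≡⟨ sym (weight-snoc a n) ⟩
    weight a (suc n)               ≡⟨ cong (λ z → toℕ z + weight (suc a) n) wa ⟩
    weight (suc a) n               ∎))
    where open ≤-Reasoning

  bordered-weight : ∀ {x i ℓ} → w i ≡ x → w (suc i + ℓ) ≡ x →
                    weight i (suc (suc ℓ)) ≡ toℕ x + toℕ x + weight (suc i) ℓ
  bordered-weight {x} {i} {ℓ} refl eq = begin
    toℕ x + weight (suc i) (suc ℓ)                    ≡⟨ cong (toℕ x +_) (weight-snoc (suc i) ℓ) ⟩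
    toℕ x + (weight (suc i) ℓ + toℕ (w (suc i + ℓ)))  ≡⟨ cong (λ z → toℕ x + (weight (suc i) ℓ + toℕ z)) eq ⟩
    toℕ x + (weight (suc i) ℓ + toℕ x)                ≡⟨ cong (toℕ x +_) (+-comm _ (toℕ x)) ⟩
    toℕ x + (toℕ x + weight (suc i) ℓ)                ≡⟨ sym (+-assoc (toℕ x) _ _) ⟩
    toℕ x + toℕ x + weight (suc i) ℓ                  ∎
    where open ≡-Reasoning

  -- Recurrence makes the weight of a sliding window of length |u| + 2 rise to that
  -- of 1u1 and fall to that of 0u0: hence there are windows 0s < 1s′ with |s|₁ ≥ |s′|₁ + 2.
  Monotone⇒¬1u1∧0u0 : Recurrent w → Monotone → ∀ {ℓ i j} → w i ≡ 1F → w j ≡ 0F → ¬ Bad ℓ i j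
  Monotone⇒¬1u1∧0u0 rec mono {ℓ} {i} {j} wi wj b with recurs rec i (2 + ℓ) j | recurs rec j (2 + ℓ) i
  ... | i′ , j≤i′ , ei | j′ , i≤j′ , ej = conclude
    -- Between `j`, where the weight is `m`, and the later occurrence `i′` of 1u1, the weight climbs
    -- to `m + 2`; the second crossing is the descent from `i` to the later occurrence `j′` of 0u0.
    (crossing (λ k → 2 + m ≤? weight k (2 + ℓ)) j≤i′
      (λ le → 1+n≰n (≤-trans (n≤1+n _) (≤-trans le (≤-reflexive light))))
      (≤-reflexive (sym (trans (sym (weight-≈ (2 + ℓ) ei)) heavy))))
    (crossing (λ k → weight k (2 + ℓ) ≤? m) i≤j′
      (λ le → 1+n≰n (≤-trans (n≤1+n _) (≤-trans (≤-reflexive (sym heavy)) le)))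
      (≤-reflexive (trans (sym (weight-≈ (2 + ℓ) ej)) light)))
    where
    open Bad b
    m = weight (suc i) ℓ
    heavy : weight i (2 + ℓ) ≡ 2 + m
    heavy = bordered-weight wi (trans closeˡ wi)
    light : weight j (2 + ℓ) ≡ m
    light = trans (bordered-weight wj (trans closeʳ wj)) (sym (weight-≈ ℓ inner))
    conclude : ∃[ a ] ¬ 2 + m ≤ weight a (2 + ℓ) × 2 + m ≤ weight (suc a) (2 + ℓ) →
               ∃[ c ] ¬ weight c (2 + ℓ) ≤ m × weight (suc c) (2 + ℓ) ≤ m → ⊥
    conclude (a , a≱ , a≥) (c , c≰ , c≤) = 1+n≰n (begin
        2 + m                                         ≤⟨ a≥ ⟩
        weight (suc a) (2 + ℓ)                        ≡⟨ cong (λ z → toℕ z + weight (suc a) (2 + ℓ)) (sym wa) ⟩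
        weight a (3 + ℓ)                              ≤⟨ mono (3 + ℓ) a c (here wa wc) ⟩
        weight c (3 + ℓ)                              ≡⟨ cong (λ z → toℕ z + weight (suc c) (2 + ℓ)) wc ⟩
        1 + weight (suc c) (2 + ℓ)                    ≤⟨ s≤s c≤ ⟩
        1 + m                                         ∎)
      where
      open ≤-Reasoning
      wa : w a ≡ 0F
      wa = rising {a} {2 + ℓ} (<-≤-trans (≰⇒> a≱) a≥)
      wc : w c ≡ 1F
      wc = falling {c} {2 + ℓ} (≤-<-trans c≤ (≰⇒> c≰))

  Monotone⇒NoBad : Recurrent w → Monotone → NoBad
  Monotone⇒NoBad rec mono ℓ i j b with w i in wi | w j in wj
  ... | 0F | 0F = Bad.different b (trans wi (sym wj))
  ... | 1F | 1F = Bad.different b (trans wi (sym wj))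
  ... | 1F | 0F = Monotone⇒¬1u1∧0u0 rec mono wi wj b
  ... | 0F | 1F = Monotone⇒¬1u1∧0u0 rec mono wj wi (Bad-sym b)

  -- Consecutive factors

  Hamming : ℕ → ℕ → ℕ → ℕ
  Hamming n i j = differences (block w i n) (block w j n)

  Hamming-suc : ∀ n i j → Hamming (suc n) i j ≡ δ (w i) (w j) + Hamming n (suc i) (suc j)
  Hamming-suc n i j = trans (cong₂ differences (block-suc i n) (block-suc j n)) (differences-∷ (w i) (w j) _ _)

  Hamming-≈ : ∀ n {i j} → i ≈[ n ] j → Hamming n i j ≡ 0
  Hamming-≈ zero    e = refl
  Hamming-≈ (suc n) {i} {j} e =
    trans (Hamming-suc n i j) (cong₂ _+_ (δ-≡ (≈-head e)) (Hamming-≈ n (≈-tail e)))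

  -- Only the positions `k` and `k + 1` are left unconstrained.
  Hamming≤2 : ∀ n k {i j} → i ≈[ k ] j → (∀ l → suc k < l → l < n → w (i + l) ≡ w (j + l)) → Hamming n i j ≤ 2
  Hamming≤2 zero          k       e f = z≤n
  Hamming≤2 (suc zero)    zero    {i} {j} e f rewrite Hamming-suc 0 i j =
    ≤-trans (+-mono-≤ (δ≤1 (w i) (w j)) (z≤n {1})) ≤-refl
  Hamming≤2 (suc (suc n)) zero    {i} {j} e f rewrite Hamming-suc (suc n) i j | Hamming-suc n (suc i) (suc j) =
    +-mono-≤ (δ≤1 (w i) (w j)) (+-mono-≤ (δ≤1 (w (suc i)) (w (suc j))) (≤-reflexive (Hamming-≈ n rest)))
    where
    rest : suc (suc i) ≈[ n ] suc (suc j)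
    rest = window λ l l<n → subst₂ (λ a b → w a ≡ w b) (shift i l) (shift j l) (f (2 + l) (s≤s (s≤s z≤n)) (s<s (s<s l<n)))
      where
      shift : ∀ i l → i + (2 + l) ≡ suc (suc i) + l
      shift i l = trans (+-suc i (suc l)) (cong suc (+-suc i l))
  Hamming≤2 (suc n) (suc k) {i} {j} e f rewrite Hamming-suc n i j | δ-≡ (≈-head e) =
    Hamming≤2 n k (≈-tail e) λ l 1+k<l l<n →
      subst₂ (λ a b → w a ≡ w b) (+-suc i l) (+-suc j l) (f (suc l) (s<s 1+k<l) (s<s l<n))

  weight≤weight+Hamming : ∀ n i j → weight i n ≤ weight j n + Hamming n i j
  weight≤weight+Hamming zero    i j = z≤n
  weight≤weight+Hamming (suc n) i j rewrite Hamming-suc n i j with w i | w j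
  ... | 0F | 0F = weight≤weight+Hamming n (suc i) (suc j)
  ... | 1F | 1F = s≤s (weight≤weight+Hamming n (suc i) (suc j))
  ... | 0F | 1F = ≤-trans (weight≤weight+Hamming n (suc i) (suc j))
                    (≤-trans (n≤1+n _) (s≤s (+-monoʳ-≤ (weight (suc j) n) (n≤1+n _))))
  ... | 1F | 0F = ≤-trans (s≤s (weight≤weight+Hamming n (suc i) (suc j)))
                    (≤-reflexive (sym (+-suc (weight (suc j) n) _)))

  -- The first difference, 0 against 1, adds one to the weight at `j` and one to the distance, and
  -- every later difference costs at most one. A distance of at most 2 thus forces the weight not to
  -- decrease.
  <⇒2+weight≤weight+Hamming : ∀ {n i j} → i <[ n ] j → 2 + weight i n ≤ weight j n + Hamming n i j
  <⇒2+weight≤weight+Hamming {suc n} {i} {j} (here p q) rewrite Hamming-suc n i j | p | q =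
    s≤s (≤-trans (s≤s (weight≤weight+Hamming n (suc i) (suc j))) (≤-reflexive (sym (+-suc (weight (suc j) n) _))))
  <⇒2+weight≤weight+Hamming {suc n} {i} {j} (there h lt)
    rewrite Hamming-suc n i j | h with w j | <⇒2+weight≤weight+Hamming lt
  ... | 0F | ih = ih
  ... | 1F | ih = s≤s ih

  -- The window read as a binary number; it serves as the measure that makes chains of successive
  -- factors finite.
  value : ℕ → ℕ → ℕ
  value i zero    = 0
  value i (suc n) = toℕ (w i) * 2 ^ n + value (suc i) n

  value<2^ : ∀ i n → value i n < 2 ^ n
  value<2^ i zero    = z<s
  value<2^ i (suc n) = begin-strict
    toℕ (w i) * 2 ^ n + value (suc i) n  <⟨ +-mono-≤-< (*-monoˡ-≤ (2 ^ n) (bit≤1 i)) (value<2^ (suc i) n) ⟩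
    1 * 2 ^ n + 2 ^ n                    ≡⟨ +-comm (1 * 2 ^ n) (2 ^ n) ⟩
    2 ^ suc n                            ∎
    where open ≤-Reasoning

  value-mono : ∀ {n i j} → i <[ n ] j → value i n < value j n
  value-mono {suc n} {i} {j} (here p q) rewrite p | q =
    <-≤-trans (value<2^ (suc i) n) (≤-trans (≤-reflexive (sym (+-identityʳ (2 ^ n)))) (m≤m+n (2 ^ n + 0) _))
  value-mono {suc n} {i} {j} (there h lt) rewrite h = +-monoʳ-< (toℕ (w j) * 2 ^ n) (value-mono lt)

  Adjacent : ℕ → ℕ → ℕ → Set
  Adjacent n i j = i <[ n ] j × ¬ (∃[ t ] i <[ n ] t × t <[ n ] j)

  Adjacent⇒Consecutive : ∀ n {i j} → Adjacent n i j → Consecutive w (block w i n) (block w j n)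
  Adjacent⇒Consecutive n {i} {j} (lt , gap) = block-fact i n , block-fact j n , <⇒lex n lt , no-between
    where
    no-between : ¬ (∃[ f ] Fact w f × block w i n <lex f × f <lex block w j n)
    no-between (f , (t , occ) , i<f , f<j) =
      gap (t , lex⇒< n (subst (block w i n <lex_) (sym occ′) i<f) ,
           lex⇒< n (subst (_<lex block w j n) (sym occ′) f<j))
      where
      occ′ : block w t n ≡ f
      occ′ = trans (cong (block w t) (sym (trans (sym (proj₁ i<f)) (length-block i n)))) occ

  Consecutive⇒Adjacent : ∀ n {i j} → Consecutive w (block w i n) (block w j n) → Adjacent n i j
  Consecutive⇒Adjacent n (_ , _ , lt , gap) =
    lex⇒< n lt , λ { (t , i<t , t<j) → gap (block w t n , block-fact t n , <⇒lex n i<t , <⇒lex n t<j) }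

  AdjacentClose : Set
  AdjacentClose = ∀ n i j → Adjacent n i j → Hamming n i j ≤ 2

  AdjacentClose⇒ConsecutiveDifferAtMostTwo : AdjacentClose → ConsecutiveDifferAtMostTwo w
  AdjacentClose⇒ConsecutiveDifferAtMostTwo close v v′ len cons@((i , occ) , (j , occ′) , _) =
    subst₂ (λ x y → differences x y ≤ 2) occ occ″
      (close n i j (Consecutive⇒Adjacent n (subst₂ (Consecutive w) (sym occ) (sym occ″) cons)))
    where
    n = length v
    occ″ : block w j n ≡ v′
    occ″ = trans (cong (block w j) len) occ′

  ConsecutiveDifferAtMostTwo⇒AdjacentClose : ConsecutiveDifferAtMostTwo w → AdjacentClose
  ConsecutiveDifferAtMostTwo⇒AdjacentClose close n i j adj =
    close _ _ (trans (length-block i n) (sym (length-block j n))) (Adjacent⇒Consecutive n adj)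

  -- Induction on a bound `N` for the difference of the values. A window strictly in between splits
  -- the pair into two pairs with smaller difference; without one the pair is adjacent and its
  -- distance is at most 2.
  AdjacentClose⇒Monotone : ExcludedMiddle 0ℓ → AdjacentClose → Monotone
  AdjacentClose⇒Monotone em close n i j = go (value j n) i j (m≤m+n _ _)
    where
    go : ∀ N i j → value j n ≤ N + value i n → i <[ n ] j → weight i n ≤ weight j n
    go zero    i j le lt = contradiction le (<⇒≱ (value-mono lt))
    go (suc N) i j le lt with em {∃[ t ] i <[ n ] t × t <[ n ] j}
    ... | no gap = +-cancelˡ-≤ 2 _ _ (begin
      2 + weight i n                ≤⟨ <⇒2+weight≤weight+Hamming lt ⟩
      weight j n + Hamming n i j    ≤⟨ +-monoʳ-≤ (weight j n) (close n i j (lt , gap)) ⟩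
      weight j n + 2                ≡⟨ +-comm _ 2 ⟩
      2 + weight j n                ∎)
      where open ≤-Reasoning
    ... | yes (t , i<t , t<j) = ≤-trans
      (go N i t (≤-pred (≤-trans (value-mono t<j) le)) i<t)
      (go N t j (≤-trans le (≤-trans (≤-reflexive (sym (+-suc N (value i n)))) (+-monoʳ-≤ N (value-mono i<t)))) t<j)

  -- The weight of the prefix of length l separates the windows into those up to i and
  -- those from j on; if two lengths did so, the weight between them would be constant.
  NoBad⇒AdjacentClose : ExcludedMiddle 0ℓ → Aperiodic w → NoBad → AdjacentClose
  NoBad⇒AdjacentClose em ap nb n i j (lt , gap) with first-difference lt
  -- The prefix weights first differ at length `suc k`. If they agree at all greater lengths, the
  -- letters agree from position `k + 2` on.
  ... | k , k<n , e , p , q with em {∃[ l ] suc k < l × l ≤ n × weight i l < weight j l}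
  ... | no none = Hamming≤2 n k e same
    where
    equal : ∀ l → suc k < l → l ≤ n → weight i l ≡ weight j l
    equal l k<l l≤n = ≤-antisym (prefix-monotone (NoBad⇒Balanced nb) l≤n lt)
      (≮⇒≥ λ less → none (l , k<l , l≤n , less))
    same : ∀ l → suc k < l → l < n → w (i + l) ≡ w (j + l)
    same l k<l l<n = toℕ-injective (+-cancelˡ-≡ (weight i l) _ _ (begin
      weight i l + toℕ (w (i + l))   ≡⟨ sym (weight-snoc i l) ⟩
      weight i (suc l)               ≡⟨ equal (suc l) (<-trans k<l (n<1+n l)) l<n ⟩
      weight j (suc l)               ≡⟨ weight-snoc j l ⟩
      weight j l + toℕ (w (j + l))   ≡⟨ cong (_+ _) (sym (equal l k<l (<⇒≤ l<n))) ⟩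
      weight i l + toℕ (w (j + l))   ∎))
      where open ≡-Reasoning
  ... | yes (l , k<l , l≤n , less) = contradiction (periodic (m≤n⇒∃[o]m+o≡n k<l)) ap
    where
    bal : Balanced
    bal = NoBad⇒Balanced nb

    -- A single `ε` serves all separating lengths at once, so it cancels when two of them are
    -- compared.
    Offset : ℕ → ℕ → Set
    Offset t ε = ∀ l → l ≤ n → weight i l < weight j l → weight t l ≡ ε + weight i l

    -- At a separating length the weights at `i` and `j` already use the whole range that balance
    -- allows, so a prefix weight not above that of `i` equals it; `high` is dual.
    low : ∀ t → (∀ l → l ≤ n → weight t l ≤ weight i l) → Offset t 0
    low t t≤i l l≤n less = ≤-antisym (t≤i l l≤n) (≤-pred (≤-trans less (bal l j t)))

    high : ∀ t → (∀ l → l ≤ n → weight j l ≤ weight t l) → Offset t 1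
    high t j≤t l l≤n less = ≤-antisym (bal l t i) (≤-trans less (j≤t l l≤n))

    -- No window lies strictly between `i` and `j`, so each is at most the one at `i` or at least
    -- the one at `j`.
    offset : ∀ t → ∃[ ε ] Offset t ε
    offset t with trichotomy n t i
    ... | inj₁ t≈i        = 0 , low t λ l l≤n → ≤-reflexive (weight-≈ l (≈-≤ l≤n t≈i))
    ... | inj₂ (inj₁ t<i) = 0 , low t λ l l≤n → prefix-monotone bal l≤n t<i
    ... | inj₂ (inj₂ i<t) with trichotomy n t j
    ... | inj₁ t≈j        = 1 , high t λ l l≤n → ≤-reflexive (weight-≈ l (≈-sym (≈-≤ l≤n t≈j)))
    ... | inj₂ (inj₁ t<j) = contradiction (t , i<t , t<j) gap
    ... | inj₂ (inj₂ j<t) = 1 , high t λ l l≤n → prefix-monotone bal l≤n j<t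

    less-k : weight i (suc k) < weight j (suc k)
    less-k = ≤-reflexive (begin
      suc (weight i (suc k))                ≡⟨ cong suc (weight-snoc i k) ⟩
      suc (weight i k + toℕ (w (i + k)))    ≡⟨ cong (λ z → suc (weight i k + toℕ z)) p ⟩
      suc (weight i k + 0)                  ≡⟨ sym (+-suc (weight i k) 0) ⟩
      weight i k + 1                        ≡⟨ cong₂ (λ a z → a + toℕ z) (weight-≈ k e) (sym q) ⟩
      weight j k + toℕ (w (j + k))          ≡⟨ sym (weight-snoc j k) ⟩
      weight j (suc k)                      ∎)
      where open ≡-Reasoning

    periodic : ∃[ o ] suc (suc k) + o ≡ l → UltimatelyPeriodic w
    periodic (o , eq) = constantWeight⇒periodic (suc k) o const
      where
      open ≡-Reasoning
      l≡ : l ≡ suc k + suc o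
      l≡ = trans (sym eq) (sym (+-suc (suc k) o))
      -- The block weight is the difference of the prefix weights at `l` and `suc k`. Both carry the
      -- same `ε`, so the difference is the one found at `i`.
      const : ∀ t → weight (t + suc k) (suc o) ≡ weight (i + suc k) (suc o)
      const t with offset t
      ... | ε , off = +-cancelˡ-≡ (weight t (suc k)) _ _ (begin
        weight t (suc k) + weight (t + suc k) (suc o)        ≡⟨ sym (weight-+ t (suc k) (suc o)) ⟩
        weight t (suc k + suc o)                             ≡⟨ cong (weight t) (sym l≡) ⟩
        weight t l                                           ≡⟨ off l l≤n less ⟩
        ε + weight i l                                       ≡⟨ cong (λ z → ε + weight i z) l≡ ⟩
        ε + weight i (suc k + suc o)                         ≡⟨ cong (ε +_) (weight-+ i (suc k) (suc o)) ⟩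
        ε + (weight i (suc k) + weight (i + suc k) (suc o))  ≡⟨ sym (+-assoc ε _ _) ⟩
        ε + weight i (suc k) + weight (i + suc k) (suc o)
          ≡⟨ cong (_+ weight (i + suc k) (suc o)) (sym (off (suc k) k<n less-k)) ⟩
        weight t (suc k) + weight (i + suc k) (suc o)        ∎)

-- Equivalence of the three conditions

theorem1p2 : ExcludedMiddle 0ℓ →
    (w : InfiniteWord) → Recurrent w → Aperiodic w →
    (Sturmian w ⇔ LexMonotoneWeight w) ×
    (LexMonotoneWeight w ⇔ ConsecutiveDifferAtMostTwo w)
theorem1p2 em w rec ap =
  mk⇔ (λ st → Monotone⇒LexMonotoneWeight (NoBad⇒Monotone (Sturmian⇒NoBad em rec ap st)))
      (λ lm → NoBad⇒Sturmian em rec ap (noBad lm)) ,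
  mk⇔ (λ lm → AdjacentClose⇒ConsecutiveDifferAtMostTwo (NoBad⇒AdjacentClose em ap (noBad lm)))
      (λ cd → Monotone⇒LexMonotoneWeight
        (AdjacentClose⇒Monotone em (ConsecutiveDifferAtMostTwo⇒AdjacentClose cd)))
  where
  open Windows w
  noBad : LexMonotoneWeight w → NoBad
  noBad lm = Monotone⇒NoBad rec (LexMonotoneWeight⇒Monotone lm)
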